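{- Consider the online ride-hitching problem with flexible time gaps $\Delta t_i=t_i-r_i\in[0,T_{ra}+T_{f0}]$ for every ride $V_i$. No deterministic online algorithm can achieve a competitive ratio better (smaller) than $$\frac{\xi(\varnothing)-T_{mu}}{\frac{\lceil L_{\min}\rceil}{v}+\frac{a+1-\lceil L_{\min}\rceil}{v_0}},$$ where $\xi(\varnothing)=\frac{\beta}{\alpha}\frac{a}{v_0}-\frac{P_0}{\alpha}$, $T_{mu}=\frac{\beta}{\alpha v_0}$, $L_{\min}=\frac{(a\beta-a\alpha-P_0v_0)v}{v_0\alpha-v\alpha+v\beta}$, $T_{ra}=\frac{\beta-\alpha}{\alpha}\frac{a}{v_0}-\frac{P_0}{\alpha}$ and $T_{f0}=\frac{P_0}{\beta-\alpha}$.
   Context: Setting. A UAV travels on the segment $[0,a]$ from the origin $O=0$ (at time $0$) to the destination $A=a$. It flies at speed $v_0>0$ (or stops), charges at all times at rate $\alpha>0$ per unit time, and while flying consumes power at rate $\beta>\alpha$ per unit time; its power must never be negative, and there is no upper limit on stored power. Its initial power $P_0$ satisfies $0\le P_0<\frac{(\beta-\alpha)a}{v_0}$. A truck ride is $V_i=(r_i,t_i,o_i,d_i,v_i)$: it is released (announced) at time $r_i$, departs at time $t_i\ge r_i$ from location $o_i$, and moves with constant velocity $v_i$ to $d_i$, where $0\le o_i<d_i\le a$. The smallest possible velocity of a truck is $v$, with $0<v<v_0$. A UAV taking a ride boards it at $(o_i,t_i)$, leaves it at $d_i$ at time $t_i+\frac{d_i-o_i}{v_i}$, and charges without consuming power while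 on it. Taking $V_i$ and then $V_j$ requires, with $P_i$ the UAV's power at time $t_i$, that $t_j\ge t_i+\frac{d_i-o_i}{v_i}+\frac{|o_j-d_i|}{v_0}$ and that the power at time $t_j$, namely $P_i+(t_j-t_i)\alpha-\frac{|o_j-d_i|\beta}{v_0}$, is nonnegative; similarly the first ride $V_1$ requires $t_1\ge\frac{o_1}{v_0}$ and $P_0+t_1\alpha-\frac{o_1}{v_0}\beta\ge0$. After its last ride the UAV goes to $A$, flying at speed $v_0$ and stopping to recharge if needed. Online model. The UAV learns of $V_i$ only at time $r_i$ and must then irrevocably accept or reject it; accepted rides must be taken. The objective is to minimize the arrival time at $A$. Competitive ratio. For a sequence $\mathbb{V}$ of rides let $\xi_{\rm ALG}(\mathbb{V})$ and $\xi_{\rm OPT}(\mathbb{V})$ be the UAV's arrival time at $A$ under the online algorithm and under an optimal offline solution (knowing all of $\mathbb{V}$ at time $0$), respectively. The competitive ratio of the algorithm is $\max_{\mathbb{V}}\frac{\xi_{\rm ALG}(\mathbb{V})}{\xi_{\rm OPT}(\mathbb{V})}$. -}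

module Defs where

open import Algebra.Bundles using (CommutativeRing)
open import Algebra.Structures using (IsCommutativeRing)
import Algebra.Construct.NaturalChoice.Max as Max
import Algebra.Definitions.RawMonoid as Multiple
open import Data.Bool using (Bool; if_then_else_)
open import Data.Integer using (ℤ; +_; -[1+_])
open import Data.List using (List; []; _∷_; _∷ʳ_; takeWhile)
open import Data.List.Relation.Binary.Permutation.Propositional using (_↭_)
open import Data.List.Relation.Binary.Subset.Propositional using (_⊆_)
open import Data.List.Relation.Unary.All using (All)
open import Data.List.Relation.Unary.Linked using (Linked)
open import Data.Nat using (ℕ; suc)
open import Data.Product using (Σ-syntax; _×_)
open import Data.Unit.Polymorphic using (⊤)
open import Level using (_⊔_) renaming (suc to lsuc)
open import Relation.Binary using (Rel; DecTotalOrder; IsDecTotalOrder)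
import Relation.Binary.Construct.NonStrictToStrict as ToStrict
open import Relation.Nullary using (¬_)

-- The inverse is total, with 0# ⁻¹ unconstrained.
record OrderedField c ℓ₁ ℓ₂ : Set (lsuc (c ⊔ ℓ₁ ⊔ ℓ₂)) where
  infix  4 _≈_ _≤_
  infixl 6 _+_ _-_
  infixl 7 _*_ _/_
  infix  8 -_
  infix  9 _⁻¹
  field
    Carrier           : Set c
    _≈_               : Rel Carrier ℓ₁
    _≤_               : Rel Carrier ℓ₂
    _+_ _*_           : Carrier → Carrier → Carrier
    -_ _⁻¹            : Carrier → Carrier
    0# 1#             : Carrier
    isCommutativeRing : IsCommutativeRing _≈_ _+_ _*_ -_ 0# 1#
    isDecTotalOrder   : IsDecTotalOrder _≈_ _≤_
    0≉1               : ¬ (0# ≈ 1#)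
    ⁻¹-cong           : ∀ {x y} → x ≈ y → x ⁻¹ ≈ y ⁻¹
    *-inverseʳ        : ∀ {x} → ¬ (x ≈ 0#) → x * x ⁻¹ ≈ 1#
    +-monoˡ-≤         : ∀ z {x y} → x ≤ y → x + z ≤ y + z
    *-nonneg          : ∀ {x y} → 0# ≤ x → 0# ≤ y → 0# ≤ x * y

  commutativeRing : CommutativeRing c ℓ₁
  commutativeRing = record { isCommutativeRing = isCommutativeRing }

  decTotalOrder : DecTotalOrder c ℓ₁ ℓ₂
  decTotalOrder = record { isDecTotalOrder = isDecTotalOrder }

  open DecTotalOrder decTotalOrder public using (_≤?_; totalOrder)
  open ToStrict _≈_ _≤_ public using (_<_)

  _-_ : Carrier → Carrier → Carrier
  x - y = x + (- y)

  _/_ : Carrier → Carrier → Carrier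
  x / y = x * y ⁻¹

  max : Carrier → Carrier → Carrier
  max = Max._⊔_ totalOrder

  abs : Carrier → Carrier
  abs x = max x (- x)

  fromℕ : ℕ → Carrier
  fromℕ n = n · 1#
    where open Multiple (CommutativeRing.+-rawMonoid commutativeRing)
            renaming (_×_ to _·_)

  fromℤ : ℤ → Carrier
  fromℤ (+ n)    = fromℕ n
  fromℤ -[1+ n ] = - fromℕ (suc n)

-- The standard library has no real numbers.  Times, positions, powers and
-- speeds are taken in an arbitrary Archimedean ordered field; classically ℝ is
-- one (and ℚ is another).  An ordered field is Archimedean precisely when it
-- has a ceiling function, which is how the property is presented here.
record ArchimedeanField c ℓ₁ ℓ₂ : Set (lsuc (c ⊔ ℓ₁ ⊔ ℓ₂)) where
  field
    orderedField : OrderedField c ℓ₁ ℓ₂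

  open OrderedField orderedField public

  field
    ⌈_⌉      : Carrier → ℤ
    ⌈⌉-upper : ∀ x → x ≤ fromℤ ⌈ x ⌉
    ⌈⌉-lower : ∀ x → fromℤ ⌈ x ⌉ - 1# < x

module RideHitching {c ℓ₁ ℓ₂} (F : ArchimedeanField c ℓ₁ ℓ₂) where
  open ArchimedeanField F

  record Parameters : Set (c ⊔ ℓ₁ ⊔ ℓ₂) where
    field
      a v₀ v α β P₀ : Carrier
      0<v₀     : 0# < v₀
      0<v      : 0# < v
      v<v₀     : v < v₀
      0<α      : 0# < α
      α<β      : α < β
      0≤P₀     : 0# ≤ P₀
      P₀-small : P₀ < ((β - α) * a) / v₀

  record Ride : Set c where
    constructor ride
    field
      release departure origin destination speed : Carrier

  open Ride public

  duration : Ride → Carrier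
  duration V = (destination V - origin V) / speed V

  module Game (params : Parameters) where
    open Parameters params

    -- The UAV when it is not on a truck.
    record State : Set c where
      constructor state
      field
        time location power : Carrier

    open State public

    start : State
    start = state 0# 0# P₀

    powerAtDeparture : State → Ride → Carrier
    powerAtDeparture s V =
      (power s + (departure V - time s) * α)
        - (abs (origin V - location s) * β) / v₀

    -- Since α < β, the UAV can do all its waiting before it flies to the
    -- origin, so nonnegative power on departure is enough for the whole flight.
    CanTake : State → Ride → Set ℓ₂
    CanTake s V =
        (time s + abs (origin V - location s) / v₀ ≤ departure V)
      × (0# ≤ powerAtDeparture s V)

    -- The state on alighting from V.
    after : State → Ride → State
    after s V = state (departure V + duration V)
                      (destination V)
                      (powerAtDeparture s V + duration V * α)

    Feasible : State → List Ride → Set ℓ₂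
    Feasible s []      = ⊤
    Feasible s (V ∷ R) = CanTake s V × Feasible (after s V) R

    -- Flying on to A costs (β - α) per unit of flying time; whatever part of
    -- this is not in store has to be charged, at rate α, while stopped.
    finish : State → Carrier
    finish s = time s + flight + max 0# (((β - α) * flight - power s) / α)
      where flight = (a - location s) / v₀

    arrival : State → List Ride → Carrier
    arrival s []      = finish s
    arrival s (V ∷ R) = arrival (after s V) R

    -- Departure times strictly increase along a feasible list of valid rides,
    -- so _⊆_ cannot let a ride be taken twice.
    IsOptimalArrival : List Ride → Carrier → Set (c ⊔ ℓ₁ ⊔ ℓ₂)
    IsOptimalArrival Vs ξ =
        (Σ[ R ∈ List Ride ] (R ⊆ Vs × Feasible start R × arrival start R ≈ ξ))
      × (∀ R → R ⊆ Vs → Feasible start R → ξ ≤ arrival start R)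

    record ValidRide (maxGap : Carrier) (V : Ride) : Set (c ⊔ ℓ₁ ⊔ ℓ₂) where
      field
        0≤release          : 0# ≤ release V
        release≤departure  : release V ≤ departure V
        gap≤maxGap         : departure V - release V ≤ maxGap
        0≤origin           : 0# ≤ origin V
        origin<destination : origin V < destination V
        destination≤a      : destination V ≤ a
        v≤speed            : v ≤ speed V

    -- A sequence of rides in the order in which they are announced.
    record Instance (maxGap : Carrier) (Vs : List Ride) : Set (c ⊔ ℓ₁ ⊔ ℓ₂) where
      field
        valid  : All (ValidRide maxGap) Vs
        sorted : Linked (λ V W → release V ≤ release W) Vs

    -- decide past V ties: whether V is accepted, given the rides listed before
    -- V and the rides listed after V but released at the same time.  Past
    -- decisions are determined by the past rides.
    Policy : Set c
    Policy = List Ride → Ride → List Ride → Bool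

    acceptedAfter : Policy → List Ride → List Ride → List Ride
    acceptedAfter decide past []         = []
    acceptedAfter decide past (V ∷ rest) =
      if decide past V (takeWhile (λ W → release W ≤? release V) rest)
      then V ∷ acceptedAfter decide (past ∷ʳ V) rest
      else acceptedAfter decide (past ∷ʳ V) rest

    accepted : Policy → List Ride → List Ride
    accepted decide = acceptedAfter decide []

    -- The algorithm decides only which rides to accept.  Between rides the UAV
    -- is taken to move as well as the accepted rides permit, so an algorithm
    -- that also chose the movement online could not arrive earlier.
    --
    -- The rides are taken in order of departure, not of announcement; hence
    -- the permutation.  Up to _≈_ only one order can be feasible.
    record OnlineAlgorithm (maxGap : Carrier) : Set (c ⊔ ℓ₁ ⊔ ℓ₂) where
      field
        decide         : Policy
        route          : ∀ {Vs} → Instance maxGap Vs → List Ride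
        route-accepted : ∀ {Vs} (I : Instance maxGap Vs) → route I ↭ accepted decide Vs
        route-feasible : ∀ {Vs} (I : Instance maxGap Vs) → Feasible start (route I)

      ξ-ALG : ∀ {Vs} → Instance maxGap Vs → Carrier
      ξ-ALG I = arrival start (route I)

    -- ρ bounds all the ratios ξ-ALG / ξ-OPT, i.e. ALG achieves competitive
    -- ratio ρ.
    IsCompetitive : ∀ {maxGap} → OnlineAlgorithm maxGap → Carrier → Set (c ⊔ ℓ₁ ⊔ ℓ₂)
    IsCompetitive {maxGap} ALG ρ =
      ∀ {Vs} (I : Instance maxGap Vs) ξ-OPT → IsOptimalArrival Vs ξ-OPT →
      OnlineAlgorithm.ξ-ALG ALG I / ξ-OPT ≤ ρ

    ξ∅ T-mu L-min T-ra T-f0 : Carrier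
    ξ∅    = (β / α) * (a / v₀) - P₀ / α
    T-mu  = β / (α * v₀)
    L-min = ((a * β - a * α - P₀ * v₀) * v) / (v₀ * α - v * α + v * β)
    T-ra  = ((β - α) / α) * (a / v₀) - P₀ / α
    T-f0  = P₀ / (β - α)

    ⌈L-min⌉ : Carrier
    ⌈L-min⌉ = fromℤ ⌈ L-min ⌉

    lowerBound : Carrier
    lowerBound = (ξ∅ - T-mu) / (⌈L-min⌉ / v + (a + 1# - ⌈L-min⌉) / v₀)

{-# OPTIONS --safe #-}
module Submission where

-- Let e be the distance for which riding exactly [0,e] after a delay δ leaves
-- exactly the energy to fly on to a.  The adversary cuts [0,e] into pieces of
-- length ℓ = e / ⌈L-min⌉ ≤ 1 and announces, one after another, rides V over these pieces,
-- each δ before its departure.  As soon as some V is accepted, it announces, at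
-- the departure time of V, a ride W over all that remains of [0,e], departing
-- from the same place at the same time as V, and stops.  So the algorithm rides
-- at most one piece, and its energy balance bounds its arrival from below by
-- ξ∅ - T-mu.  The clairvoyant UAV rides all of [0,e] and meets the corresponding
-- energy bound exactly.  Its arrival is at most the denominator of lowerBound,
-- in which the additional 1/v₀ pays for the delay δ.

open import Defs
open import Algebra.Bundles using (CommutativeRing)
import Algebra.Construct.NaturalChoice.Max as NaturalMax
open import Algebra.Solver.Ring.AlmostCommutativeRing
  using (fromCommutativeRing; _-Raw-AlmostCommutative⟶_)
open import Data.Bool using (true; false; if_then_else_)
open import Data.Integer as ℤ using (ℤ; +_; -[1+_])
import Data.Integer.Properties as ℤ
open import Data.List using (List; []; _∷_; _∷ʳ_; takeWhile)
open import Data.List.Relation.Binary.Permutation.Propositional as Perm using (_↭_; ↭-sym)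
open import Data.List.Relation.Binary.Permutation.Propositional.Properties
  using (All-resp-↭; ∈-resp-↭)
open import Data.List.Relation.Binary.Subset.Propositional using (_⊆_)
open import Data.List.Relation.Binary.Subset.Propositional.Properties using (∷⁺ʳ; All-resp-⊇)
open import Data.List.Relation.Unary.All as All using (All; []; _∷_)
open import Data.List.Relation.Unary.Any using (here; there)
open import Data.List.Relation.Unary.Linked using (Linked; [-]; _∷_)
open import Data.Maybe using (Maybe; just; nothing)
open import Data.Nat as ℕ using (ℕ; zero; suc)
import Data.Nat.Properties as ℕ
open import Data.Product using (∃-syntax; _×_; _,_; proj₁; proj₂)
open import Data.Sum using (inj₁; inj₂)
open import Data.Unit.Polymorphic using (tt)
open import Function using (_∘_; id)
open import Level using (_⊔_)
open import Relation.Binary using (DecTotalOrder)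
import Relation.Binary.Construct.NonStrictToStrict as ToStrict
open import Relation.Binary.PropositionalEquality as ≡ using (_≡_)
open import Relation.Nullary using (¬_; yes; no; contradiction)

-- Normalising ring expressions with integer coefficients.

module IntegerCoefficients {c ℓ} (R : CommutativeRing c ℓ) where
  open CommutativeRing R
  open import Algebra.Properties.Ring ring
  open import Algebra.Properties.Semiring.Mult.TCOptimised semiring renaming (_×_ to _·_)
  open import Relation.Binary.Reasoning.Setoid setoid

  private
    -- With the optimised multiples `1 · 1#` computes to `1#`, so `con (+ 1)` denotes `1#` itself
    -- and not a sum with `0#`.
    ⟦_⟧ : ℤ → Carrier
    ⟦ + n ⟧      = n · 1#
    ⟦ -[1+ n ] ⟧ = - (suc n · 1#)

    -‿homo : ∀ i → ⟦ ℤ.- i ⟧ ≈ - ⟦ i ⟧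
    -‿homo (+ zero)  = sym -0#≈0#
    -‿homo (+ suc n) = refl
    -‿homo -[1+ n ]  = sym (-‿involutive _)

    ⊖-homo : ∀ m n → ⟦ m ℤ.⊖ n ⟧ ≈ m · 1# - n · 1#
    ⊖-homo m       zero    = sym (trans (+-congˡ -0#≈0#) (+-identityʳ _))
    ⊖-homo zero    (suc n) = sym (+-identityˡ _)
    ⊖-homo (suc m) (suc n) = begin
      ⟦ suc m ℤ.⊖ suc n ⟧             ≡⟨ ≡.cong ⟦_⟧ (ℤ.[1+m]⊖[1+n]≡m⊖n m n) ⟩
      ⟦ m ℤ.⊖ n ⟧                     ≈⟨ ⊖-homo m n ⟩
      m · 1# - n · 1#                 ≈⟨ +-congʳ (xyx⁻¹≈y 1# _) ⟨
      1# + m · 1# - 1# - n · 1#       ≈⟨ +-assoc _ _ _ ⟩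
      1# + m · 1# + (- 1# - n · 1#)   ≈⟨ +-congˡ (-‿+-comm 1# _) ⟩
      1# + m · 1# - (1# + n · 1#)     ≈⟨ +-cong (1+× m 1#) (-‿cong (1+× n 1#)) ⟨
      suc m · 1# - suc n · 1#         ∎

    +-homo : ∀ i j → ⟦ i ℤ.+ j ⟧ ≈ ⟦ i ⟧ + ⟦ j ⟧
    +-homo (+ m)    (+ n)    = ×-homo-+ 1# m n
    +-homo (+ m)    -[1+ n ] = ⊖-homo m (suc n)
    +-homo -[1+ m ] (+ n)    = trans (⊖-homo n (suc m)) (+-comm _ _)
    +-homo -[1+ m ] -[1+ n ] = begin
      - (suc (suc (m ℕ.+ n)) · 1#)   ≡⟨ ≡.cong (λ k → - (suc k · 1#)) (ℕ.+-suc m n) ⟨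
      - ((suc m ℕ.+ suc n) · 1#)     ≈⟨ -‿cong (×-homo-+ 1# (suc m) (suc n)) ⟩
      - (suc m · 1# + suc n · 1#)    ≈⟨ -‿+-comm _ _ ⟨
      - (suc m · 1#) - suc n · 1#    ∎

    *-homo⁺ : ∀ m j → ⟦ + m ℤ.* j ⟧ ≈ m · 1# * ⟦ j ⟧
    *-homo⁺ m (+ n)    = begin
      ⟦ + m ℤ.* + n ⟧   ≡⟨ ≡.cong ⟦_⟧ (ℤ.pos-* m n) ⟨
      (m ℕ.* n) · 1#    ≈⟨ ×1-homo-* m n ⟩
      m · 1# * n · 1#   ∎
    *-homo⁺ m -[1+ n ] = begin
      ⟦ + m ℤ.* ℤ.- (+ suc n) ⟧    ≡⟨ ≡.cong ⟦_⟧ (ℤ.neg-distribʳ-* (+ m) (+ suc n)) ⟨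
      ⟦ ℤ.- (+ m ℤ.* + suc n) ⟧    ≈⟨ -‿homo (+ m ℤ.* + suc n) ⟩
      - ⟦ + m ℤ.* + suc n ⟧        ≈⟨ -‿cong (*-homo⁺ m (+ suc n)) ⟩
      - (m · 1# * suc n · 1#)      ≈⟨ -‿distribʳ-* _ _ ⟩
      m · 1# * - (suc n · 1#)      ∎

    *-homo : ∀ i j → ⟦ i ℤ.* j ⟧ ≈ ⟦ i ⟧ * ⟦ j ⟧
    *-homo (+ m)    j = *-homo⁺ m j
    *-homo -[1+ m ] j = begin
      ⟦ ℤ.- (+ suc m) ℤ.* j ⟧      ≡⟨ ≡.cong ⟦_⟧ (ℤ.neg-distribˡ-* (+ suc m) j) ⟨
      ⟦ ℤ.- (+ suc m ℤ.* j) ⟧      ≈⟨ -‿homo (+ suc m ℤ.* j) ⟩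
      - ⟦ + suc m ℤ.* j ⟧          ≈⟨ -‿cong (*-homo⁺ (suc m) j) ⟩
      - (suc m · 1# * ⟦ j ⟧)       ≈⟨ -‿distribˡ-* _ _ ⟩
      - (suc m · 1#) * ⟦ j ⟧       ∎

    homomorphism : ℤ.+-*-rawRing -Raw-AlmostCommutative⟶ fromCommutativeRing R
    homomorphism = record
      { ⟦_⟧    = ⟦_⟧
      ; +-homo = +-homo
      ; *-homo = *-homo
      ; -‿homo = -‿homo
      ; 0-homo = refl
      ; 1-homo = refl
      }

    ⟦⟧-≟ : ∀ i j → Maybe (⟦ i ⟧ ≈ ⟦ j ⟧)
    ⟦⟧-≟ i j with i ℤ.≟ j
    ... | yes i≡j = just (reflexive (≡.cong ⟦_⟧ i≡j))
    ... | no  _   = nothing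

  open import Algebra.Solver.Ring ℤ.+-*-rawRing (fromCommutativeRing R)
    homomorphism ⟦⟧-≟ public

-- Arithmetic and order in an ordered field.

module OrderedFieldProperties {c ℓ₁ ℓ₂} (F : OrderedField c ℓ₁ ℓ₂) where
  open OrderedField F
  open CommutativeRing commutativeRing public
    using (setoid; refl; sym; trans; reflexive; +-congˡ; +-congʳ; *-congˡ; *-congʳ; -‿cong;
           +-identityˡ; +-identityʳ; +-comm; *-comm; zeroˡ; -‿inverseʳ)
  open DecTotalOrder decTotalOrder public
    using (antisym; total)
    renaming (refl to ≤-refl; reflexive to ≤-reflexive; trans to ≤-trans)
  open IntegerCoefficients commutativeRing public
    using (Polynomial; solve; con; _:=_; _:+_; _:*_; _:-_; :-_)

  private
    module Max = NaturalMax totalOrder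
    module Strict = ToStrict _≈_ _≤_

  infixl 9 _≤≈_
  _≤≈_ : ∀ {x y z} → x ≤ y → y ≈ z → x ≤ z
  x≤y ≤≈ y≈z = ≤-trans x≤y (≤-reflexive y≈z)

  :0 :1 : ∀ {n} → Polynomial n
  :0 {n} = con {n} (+ 0)
  :1 {n} = con {n} (+ 1)

  -- In modulo h₁ (modulo h₂ ...) the innermost identity has the multiples of
  -- h₁, h₂, ... at the end of its right-hand side, in this order.
  modulo : ∀ {p q k x y} → p ≈ q → x ≈ y + k * (p - q) → x ≈ y
  modulo {p} {q} {k} {x} {y} p≈q x≈ = begin
    x                ≈⟨ x≈ ⟩
    y + k * (p - q)  ≈⟨ +-congˡ (*-congˡ (+-congʳ p≈q)) ⟩
    y + k * (q - q)  ≈⟨ solve 3 (λ y k q → y :+ k :* (q :- q) := y) refl y k q ⟩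
    y                ∎
    where open import Relation.Binary.Reasoning.Setoid setoid

  -- Reduces inequalities to ring identities: a visibly nonnegative difference `d` is supplied, and
  -- the solver checks the equation.
  0≤⇒≤ : ∀ {x y d} → 0# ≤ d → y ≈ x + d → x ≤ y
  0≤⇒≤ {x} {y} {d} 0≤d y≈x+d =
    ≤-trans (≤-reflexive (sym (+-identityˡ x)))
      (+-monoˡ-≤ x 0≤d ≤≈ trans (+-comm d x) (sym y≈x+d))

  ≤⇒0≤ : ∀ {x y} → x ≤ y → 0# ≤ y - x
  ≤⇒0≤ {x} x≤y = ≤-trans (≤-reflexive (sym (-‿inverseʳ x))) (+-monoˡ-≤ (- x) x≤y)

  +-nonneg : ∀ {x y} → 0# ≤ x → 0# ≤ y → 0# ≤ x + y
  +-nonneg 0≤x 0≤y = ≤-trans 0≤x (0≤⇒≤ 0≤y refl)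

  <⇒≱ : ∀ {x y} → x < y → ¬ (y ≤ x)
  <⇒≱ = Strict.<⇒≱ antisym

  <-≤-trans : ∀ {x y z} → x < y → y ≤ z → x < z
  <-≤-trans = Strict.<-≤-trans sym ≤-trans antisym (λ y≈z x≤y → x≤y ≤≈ y≈z)

  ≤-<-trans : ∀ {x y z} → x ≤ y → y < z → x < z
  ≤-<-trans = Strict.≤-<-trans ≤-trans antisym (λ y≈z y≤x → ≤-trans (≤-reflexive (sym y≈z)) y≤x)

  <⇒0< : ∀ {x y} → x < y → 0# < y - x
  <⇒0< {x} {y} (x≤y , x≉y) = ≤⇒0≤ x≤y , λ 0≈y-x → x≉y
    (modulo 0≈y-x (solve 2 (λ x y → x := y :+ :1 :* (:0 :- (y :- x))) refl x y))

  0<⇒< : ∀ {x y d} → 0# < d → y ≈ x + d → x < y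
  0<⇒< {x} {y} {d} (0≤d , 0≉d) y≈x+d = 0≤⇒≤ 0≤d y≈x+d , λ x≈y → 0≉d
    (modulo y≈x+d (modulo x≈y (solve 3
      (λ x y d → :0 := d :+ :1 :* (y :- (x :+ d)) :+ :1 :* (x :- y)) refl x y d)))

  +-pos-nonneg : ∀ {x y} → 0# < x → 0# ≤ y → 0# < x + y
  +-pos-nonneg 0<x 0≤y = <-≤-trans 0<x (0≤⇒≤ 0≤y refl)

  0<⇒≉0 : ∀ {x} → 0# < x → ¬ (x ≈ 0#)
  0<⇒≉0 (_ , 0≉x) x≈0 = 0≉x (sym x≈0)

  *-inverse : ∀ {x} → 0# < x → x * x ⁻¹ ≈ 1#
  *-inverse 0<x = *-inverseʳ (0<⇒≉0 0<x)

  *-pos : ∀ {x y} → 0# < x → 0# < y → 0# < x * y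
  *-pos {x} {y} 0<x@(0≤x , 0≉x) (0≤y , 0≉y) = *-nonneg 0≤x 0≤y , λ 0≈xy → 0≉y
    (modulo (*-inverse 0<x) (modulo 0≈xy (solve 3
      (λ x y x⁻¹ → :0 := y :+ y :* (x :* x⁻¹ :- :1) :+ x⁻¹ :* (:0 :- x :* y)) refl x y (x ⁻¹))))

  0<1 : 0# < 1#
  0<1 = 0≤1 , 0≉1
    where
    0≤1 : 0# ≤ 1#
    0≤1 with total 0# 1#
    ... | inj₁ 0≤1 = 0≤1
    ... | inj₂ 1≤0 = *-nonneg 0≤-1 0≤-1 ≤≈ solve 0 ((:0 :- :1) :* (:0 :- :1) := :1) refl
      where 0≤-1 = ≤⇒0≤ 1≤0

  fromℕ-pos : ∀ n → 0# < fromℕ (suc n)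
  fromℕ-pos zero    = +-pos-nonneg 0<1 ≤-refl
  fromℕ-pos (suc n) = +-pos-nonneg 0<1 (proj₁ (fromℕ-pos n))

  -- If `x ≤ 0#`, the product is both nonpositive and nonnegative, hence zero, and multiplying by
  -- `y ⁻¹` gives `x ≈ 0#`.
  *-cancel-nonneg : ∀ {x y} → 0# < y → 0# ≤ x * y → 0# ≤ x
  *-cancel-nonneg {x} {y} 0<y 0≤xy with total 0# x
  ... | inj₁ 0≤x = 0≤x
  ... | inj₂ x≤0 = ≤-reflexive (sym (modulo (*-inverse 0<y) (modulo xy≈0 (solve 3
        (λ x y y⁻¹ → x := :0 :+ (:- x) :* (y :* y⁻¹ :- :1) :+ y⁻¹ :* (x :* y :- :0))
        refl x y (y ⁻¹)))))
    where
    xy≤0 : x * y ≤ 0#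
    xy≤0 = 0≤⇒≤ (*-nonneg (≤⇒0≤ x≤0) (proj₁ 0<y))
      (solve 2 (λ x y → :0 := x :* y :+ (:0 :- x) :* y) refl x y)
    xy≈0 : x * y ≈ 0#
    xy≈0 = antisym xy≤0 0≤xy

  *-cancel-pos : ∀ {x y} → 0# < y → 0# < x * y → 0# < x
  *-cancel-pos {x} {y} 0<y (0≤xy , 0≉xy) = *-cancel-nonneg 0<y 0≤xy ,
    λ 0≈x → 0≉xy (trans (sym (zeroˡ y)) (*-congʳ 0≈x))

  ⁻¹-pos : ∀ {x} → 0# < x → 0# < x ⁻¹
  ⁻¹-pos {x} 0<x = *-cancel-pos 0<x
    (<-≤-trans 0<1 (≤-reflexive (trans (sym (*-inverse 0<x)) (*-comm x _))))

  ⁻¹-antimono : ∀ {x y} → 0# < x → x ≤ y → y ⁻¹ ≤ x ⁻¹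
  ⁻¹-antimono {x} {y} 0<x x≤y =
    0≤⇒≤ (*-nonneg (*-nonneg (proj₁ (⁻¹-pos 0<x)) (proj₁ (⁻¹-pos 0<y))) (≤⇒0≤ x≤y))
      (modulo (*-inverse 0<x) (modulo (*-inverse 0<y) (solve 4
        (λ x y x⁻¹ y⁻¹ → x⁻¹ := y⁻¹ :+ x⁻¹ :* y⁻¹ :* (y :- x)
          :+ y⁻¹ :* (x :* x⁻¹ :- :1) :+ (:- x⁻¹) :* (y :* y⁻¹ :- :1))
        refl x y (x ⁻¹) (y ⁻¹))))
    where
    0<y = <-≤-trans 0<x x≤y

  ⁻¹-unique : ∀ {x y} → 0# < x → x * y ≈ 1# → x ⁻¹ ≈ y
  ⁻¹-unique {x} {y} 0<x xy≈1 = modulo xy≈1 (modulo (*-inverse 0<x) (solve 3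
    (λ x y x⁻¹ → x⁻¹ := y :+ (:- x⁻¹) :* (x :* y :- :1) :+ y :* (x :* x⁻¹ :- :1))
    refl x y (x ⁻¹)))

  x≤max : ∀ x y → x ≤ max x y
  x≤max = Max.x≤x⊔y

  y≤max : ∀ x y → y ≤ max x y
  y≤max = Max.x≤y⊔x

  max-nonpos : ∀ {y} → y ≤ 0# → max 0# y ≈ 0#
  max-nonpos y≤0 = Max.x≤y⇒y⊔x≈y y≤0

  x≤abs : ∀ x → x ≤ abs x
  x≤abs x = x≤max x (- x)

  0≤abs : ∀ x → 0# ≤ abs x
  0≤abs x with total 0# x
  ... | inj₁ 0≤x = ≤-trans 0≤x (x≤abs x)
  ... | inj₂ x≤0 = ≤-trans (≤⇒0≤ x≤0 ≤≈ +-identityˡ (- x)) (y≤max x (- x))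

  abs-zero : ∀ {x} → x ≈ 0# → abs x ≈ 0#
  abs-zero {x} x≈0 = trans (Max.⊔-cong x≈0 (trans (-‿cong x≈0) -0≈0)) (Max.⊔-idem 0#)
    where
    -0≈0 : - 0# ≈ 0#
    -0≈0 = solve 0 (:- :0 := :0) refl

module Adversary {c ℓ₁ ℓ₂} (F : ArchimedeanField c ℓ₁ ℓ₂)
                 (params : RideHitching.Parameters F) where
  open RideHitching F
  open ArchimedeanField F
  open OrderedFieldProperties orderedField
  open Parameters params
  open Game params

  -- As `_/_` unfolds to multiplication by an inverse, these are the atoms in which the solver sees
  -- quotients by `v`, `v₀` and `α`.
  u w g : Carrier
  u = v ⁻¹
  w = v₀ ⁻¹
  g = α ⁻¹

  0<u = ⁻¹-pos 0<v
  0<w = ⁻¹-pos 0<v₀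
  0<g = ⁻¹-pos 0<α
  vu≈1  = *-inverse 0<v
  v₀w≈1 = *-inverse 0<v₀
  αg≈1  = *-inverse 0<α

  0<β : 0# < β
  0<β = <-≤-trans 0<α (proj₁ α<β)

  -- Energy balance of a route.

  ridden : List Ride → Carrier
  ridden []      = 0#
  ridden (V ∷ R) = (destination V - origin V) + ridden R

  -- Needed because the route of an algorithm is known only up to a permutation of the accepted
  -- rides.
  ridden-↭ : ∀ {R S} → R ↭ S → ridden R ≈ ridden S
  ridden-↭ Perm.refl          = refl
  ridden-↭ (Perm.prep V R↭S)  = +-congˡ (ridden-↭ R↭S)
  ridden-↭ (Perm.swap {R} {S} V W R↭S) = modulo (ridden-↭ R↭S) (solve 4
    (λ x y r s → x :+ (y :+ r) := y :+ (x :+ s) :+ :1 :* (r :- s)) refl _ _ (ridden R) (ridden S))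
  ridden-↭ (Perm.trans R↭S S↭T) = trans (ridden-↭ R↭S) (ridden-↭ S↭T)

  -- The charging rate is the same on trucks, in flight and at rest, so power
  -- grows with time except for the energy that flying uses, and at least
  -- a - location s - ridden R has to be flown.
  arrival-bound : ∀ s R →
    time s - g * power s + β * g * w * (a - location s - ridden R) ≤ arrival s R
  arrival-bound (state t l p) [] = 0≤⇒≤ (≤⇒0≤ (y≤max 0# short))
    (modulo αg≈1 (solve 9
      (λ t l p a α β w g m →
         t :+ (a :- l) :* w :+ m
           := t :- g :* p :+ β :* g :* w :* (a :- l :- :0)
              :+ (m :- ((β :- α) :* ((a :- l) :* w) :- p) :* g)
              :+ (:- ((a :- l) :* w)) :* (α :* g :- :1))
      refl t l p a α β w g (max 0# short)))
    where short = ((β - α) * ((a - l) * w) - p) * g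
  arrival-bound s@(state t l p) (V@(ride r dep o d sp) ∷ R) = ≤-trans
    (0≤⇒≤ (*-nonneg (*-nonneg (*-nonneg (proj₁ 0<β) (proj₁ 0<g)) (proj₁ 0<w)) (≤⇒0≤ (x≤abs (o - l))))
      (modulo αg≈1 (solve 14
        (λ t l p dep o d dur b tot a α β w g →
           dep :+ dur :- g :* (p :+ (dep :- t) :* α :- b :* β :* w :+ dur :* α)
               :+ β :* g :* w :* (a :- d :- tot)
             := t :- g :* p :+ β :* g :* w :* (a :- l :- ((d :- o) :+ tot))
                :+ β :* g :* w :* (b :- (o :- l))
                :+ (:- (dep :+ dur :- t)) :* (α :* g :- :1))
        refl t l p dep o d (duration V) (abs (o - l)) (ridden R) a α β w g)))
    (arrival-bound (after s V) R)

  -- What a policy accepts.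

  acceptedAfter-⊆ : ∀ decide past Vs → acceptedAfter decide past Vs ⊆ Vs
  acceptedAfter-⊆ decide past (V ∷ Vs)
    with decide past V (takeWhile (λ W → release W ≤? release V) Vs)
  ... | false = there ∘ acceptedAfter-⊆ decide (past ∷ʳ V) Vs
  ... | true  = λ where
    (here W≡V)  → here W≡V
    (there W∈)  → there (acceptedAfter-⊆ decide (past ∷ʳ V) Vs W∈)

  -- Strictly later announcements leave the list of ties empty, so the decision on `V` is the same
  -- for every such continuation. This lets the adversary choose the continuation after seeing the
  -- decision.
  acceptedAfter-alone : ∀ decide past {V} Vs {b} →
    All (λ W → release V < release W) Vs → decide past V [] ≡ b →
    acceptedAfter decide past (V ∷ Vs) ≡
      (if b then V ∷ acceptedAfter decide (past ∷ʳ V) Vs else acceptedAfter decide (past ∷ʳ V) Vs)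
  acceptedAfter-alone _ _ []                []        ≡.refl = ≡.refl
  acceptedAfter-alone _ _ {V} (W ∷ Vs) (V<W ∷ _) ≡.refl with release W ≤? release V
  ... | yes W≤V = contradiction W≤V (<⇒≱ V<W)
  ... | no  _   = ≡.refl

  -- Rides on a common line in space and time.

  -- All rides of the adversary lie on the line location = v * (time - δ), so two
  -- rides that overlap exclude each other.
  module Line (δ e ℓ : Carrier) (0<δ : 0# < δ) (0≤e : 0# ≤ e) (0<ℓ : 0# < ℓ) (ℓ≤1 : ℓ ≤ 1#)
    -- Riding exactly as far as e leaves exactly the energy to fly on.
    (tight : δ + e * u + (a - e) * w ≈ β * g * w * (a - e) - g * P₀) where

    -- The time `x * u` is `δ` before the line passes `x`; bounding announcements by it keeps those
    -- of successive pieces in order. The speed is given by `_≡_` so that matching turns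
    -- `duration V` into a multiple of `u`.
    record OnLine (x : Carrier) (V : Ride) : Set (c ⊔ ℓ₁ ⊔ ℓ₂) where
      constructor onLine
      field
        x≤origin           : x ≤ origin V
        origin<destination : origin V < destination V
        destination≤e      : destination V ≤ e
        on-time            : departure V ≈ δ + origin V * u
        speed≡v            : speed V ≡ v
        announced          : x * u ≤ release V
        release≤departure  : release V ≤ departure V
        gap≤δ              : departure V - release V ≤ δ

    open OnLine

    weaken : ∀ {x y V} → x ≤ y → OnLine y V → OnLine x V
    weaken {x} {y} x≤y V = record
      { x≤origin           = ≤-trans x≤y (x≤origin V)
      ; origin<destination = origin<destination V
      ; destination≤e      = destination≤e V
      ; on-time            = on-time V
      ; speed≡v            = speed≡v V
      ; announced          = ≤-trans (0≤⇒≤ (*-nonneg (≤⇒0≤ x≤y) (proj₁ 0<u))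
          (solve 3 (λ x y u → y :* u := x :* u :+ (y :- x) :* u) refl x y u)) (announced V)
      ; release≤departure  = release≤departure V
      ; gap≤δ              = gap≤δ V
      }

    -- On the line, a ride that can be taken after another starts where the
    -- latter has ended or further on.
    ridden-from-origin : ∀ {x} s V R → All (OnLine x) (V ∷ R) → Feasible s (V ∷ R) →
      ridden (V ∷ R) ≤ e - origin V
    ridden-from-origin s V@(ride r t o d _) [] (VL ∷ _) _ =
      0≤⇒≤ (≤⇒0≤ (destination≤e VL))
        (solve 3 (λ e o d → e :- o := d :- o :+ :0 :+ (e :- d)) refl e o d)
    ridden-from-origin s V@(ride r t o d _) (W@(ride _ t′ o′ _ _) ∷ R)
      (onLine _ _ _ on-time-V ≡.refl _ _ _ ∷ WL ∷ RL) (_ , feasible@((reach , _) , _)) =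
      0≤⇒≤ (+-nonneg (≤⇒0≤ (ridden-from-origin (after s V) W R (WL ∷ RL) feasible)) 0≤o′-d)
        (solve 5 (λ e o d o′ z → e :- o := d :- o :+ z :+ (e :- o′ :- z :+ (o′ :- d)))
          refl e o d o′ (ridden (W ∷ R)))
      where
      0≤o′-d : 0# ≤ o′ - d
      0≤o′-d = *-cancel-nonneg 0<u
        (+-nonneg (≤⇒0≤ reach) (*-nonneg (0≤abs (o′ - d)) (proj₁ 0<w)) ≤≈
          modulo on-time-V (modulo (on-time WL) (solve 9
            (λ t t′ o o′ d u δ w b →
              t′ :- (t :+ (d :- o) :* u :+ b :* w) :+ b :* w
                := (o′ :- d) :* u :+ (:- :1) :* (t :- (δ :+ o :* u)) :+ :1 :* (t′ :- (δ :+ o′ :* u)))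
            refl t t′ o o′ d u δ w (abs (o′ - d)))))

    ridden-bound : ∀ {x} s R → x ≤ e → All (OnLine x) R → Feasible s R → ridden R ≤ e - x
    ridden-bound s []      x≤e _         _        = ≤⇒0≤ x≤e
    ridden-bound {x} s (V ∷ R) _ (VL ∷ RL) feasible =
      ≤-trans (ridden-from-origin s V R (VL ∷ RL) feasible)
        (0≤⇒≤ (≤⇒0≤ (x≤origin VL))
          (solve 3 (λ e x o → e :- x := e :- o :+ (o :- x)) refl e x (origin V)))

    -- The clairvoyant UAV.

    ξ* : Carrier
    ξ* = δ + e * u + (a - e) * w

    -- The energy bound falls as `ridden` grows, and no more than `e` can be ridden; at `e` the
    -- bound equals `ξ*` by `tight`.
    ξ*≤arrival : ∀ {R} → All (OnLine 0#) R → Feasible start R → ξ* ≤ arrival start R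
    ξ*≤arrival {R} RL feasible = ≤-trans
      (0≤⇒≤ (*-nonneg (*-nonneg (*-nonneg (proj₁ 0<β) (proj₁ 0<g)) (proj₁ 0<w))
              (≤⇒0≤ (ridden-bound start R 0≤e RL feasible)))
        (modulo (sym tight) (solve 9
          (λ δ e u w a β g p r →
            :0 :- g :* p :+ β :* g :* w :* (a :- :0 :- r)
              := δ :+ e :* u :+ (a :- e) :* w :+ β :* g :* w :* (e :- :0 :- r)
                 :+ :1 :* (β :* g :* w :* (a :- e) :- g :* p :- (δ :+ e :* u :+ (a :- e) :* w)))
          refl δ e u w a β g P₀ (ridden R))))
      (arrival-bound start R)

    -- Invariant of the clairvoyant UAV: it is at `x` in time for the truck there and has spent no
    -- energy, so its power is `P₀` plus all that was charged.
    record Waiting (x : Carrier) (s : State) : Set (ℓ₁ ⊔ ℓ₂) where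
      constructor waiting
      field
        at-x     : location s ≈ x
        not-late : time s ≤ δ + x * u
        no-flown : power s ≈ P₀ + time s * α

    truck : Carrier → Carrier → Carrier → Ride
    truck r x d = ride r (δ + x * u) x d v

    after-truck : ∀ {s x} r d → 0# ≤ x → Waiting x s →
      CanTake s (truck r x d) × Waiting d (after s (truck r x d))
    after-truck {s} {x} r d 0≤x (waiting at-x not-late no-flown) =
      ( ≤-trans (≤-reflexive (modulo abs≈0 (solve 3
          (λ t b w → t :+ b :* w := t :+ w :* (b :- :0)) refl (time s) b w))) not-late
      , ≤-trans (+-nonneg 0≤P₀ (*-nonneg 0≤dep (proj₁ 0<α)))
          (≤-reflexive (sym (modulo no-flown (modulo abs≈0 (solve 8
            (λ p t dep α b β w P₀ → p :+ (dep :- t) :* α :- b :* β :* w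
              := P₀ :+ dep :* α :+ :1 :* (p :- (P₀ :+ t :* α)) :+ (:- (β :* w)) :* (b :- :0))
            refl (power s) (time s) dep α b β w P₀))))) )
      , waiting refl
          (≤-reflexive (solve 4 (λ δ x d u → δ :+ x :* u :+ (d :- x) :* u := δ :+ d :* u)
            refl δ x d u))
          (modulo no-flown (modulo abs≈0 (solve 9
            (λ p t dep α b β w P₀ dur → p :+ (dep :- t) :* α :- b :* β :* w :+ dur :* α
              := P₀ :+ (dep :+ dur) :* α :+ :1 :* (p :- (P₀ :+ t :* α)) :+ (:- (β :* w)) :* (b :- :0))
            refl (power s) (time s) dep α b β w P₀ (duration (truck r x d)))))
      where
      dep = δ + x * u
      0≤dep : 0# ≤ dep
      0≤dep = +-nonneg (proj₁ 0<δ) (*-nonneg 0≤x (proj₁ 0<u))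
      b = abs (x - location s)
      abs≈0 : b ≈ 0#
      abs≈0 = abs-zero (modulo at-x (solve 2
        (λ x l → x :- l := :0 :+ (:- :1) :* (l :- x)) refl x (location s)))

    -- By `tight`, the power stored at `e` is exactly what the remaining flight uses, so the `max`
    -- in `finish` vanishes.
    finish-from-e : ∀ s → location s ≡ e → time s ≈ δ + e * u → power s ≈ P₀ + time s * α →
      finish s ≈ ξ*
    finish-from-e s@(state t _ p) ≡.refl on-time no-flown = modulo on-time
      (trans (+-congˡ (max-nonpos (≤-reflexive nothing-to-charge))) (solve 6
        (λ t δ a e u w → t :+ (a :- e) :* w :+ :0
          := δ :+ e :* u :+ (a :- e) :* w :+ :1 :* (t :- (δ :+ e :* u)))
        refl t δ a e u w))
      where
      nothing-to-charge : ((β - α) * ((a - e) * w) - p) * g ≈ 0#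
      nothing-to-charge = modulo on-time (modulo no-flown (modulo tight (modulo αg≈1 (solve 11
        (λ t δ a e u w p g α β P₀ → ((β :- α) :* ((a :- e) :* w) :- p) :* g
          := :0 :+ (:- :1) :* (t :- (δ :+ e :* u))
             :+ (:- g) :* (p :- (P₀ :+ t :* α))
             :+ (:- :1) :* (δ :+ e :* u :+ (a :- e) :* w :- (β :* g :* w :* (a :- e) :- g :* P₀))
             :+ (:- ((a :- e) :* w :+ t)) :* (α :* g :- :1))
        refl t δ a e u w p g α β P₀))))

    final-truck : ∀ {s x} r → 0# ≤ x → Waiting x s →
      Feasible s (truck r x e ∷ []) × arrival s (truck r x e ∷ []) ≈ ξ*
    final-truck {s} {x} r 0≤x s-waiting =
      (proj₁ taken , tt) ,
      finish-from-e (after s (truck r x e)) ≡.refl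
        (solve 4 (λ δ x e u → δ :+ x :* u :+ (e :- x) :* u := δ :+ e :* u) refl δ x e u)
        (Waiting.no-flown (proj₂ taken))
      where taken = after-truck {s} {x} r e 0≤x s-waiting

    -- The adaptive adversary.

    -- The outcome of the game from `x` on, as needed for recursion. `OPT-route` allows any waiting
    -- state, so that a ride can be put in front; `ALG-rides≤1` counts only acceptances within `Vs`,
    -- which suffices because the game goes on only after rejections.
    record Duel (decide : Policy) (past : List Ride) (x : Carrier) (Vs : List Ride)
      : Set (c ⊔ ℓ₁ ⊔ ℓ₂) where
      field
        line        : All (OnLine x) Vs
        sorted      : Linked (λ V W → release V ≤ release W) Vs
        ALG-rides≤1 : ∀ {s R} → R ↭ acceptedAfter decide past Vs → Feasible s R → ridden R ≤ 1#
        OPT-route   : ∀ s → Waiting x s →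
          ∃[ R ] R ⊆ Vs × Feasible s R × arrival s R ≈ ξ*

    onLine-truck : ∀ {x d} r → x < d → d ≤ e →
      x * u ≤ r → r ≤ δ + x * u → OnLine x (truck r x d)
    onLine-truck {x} r x<d d≤e xu≤r r≤dep = record
      { x≤origin           = ≤-refl
      ; origin<destination = x<d
      ; destination≤e      = d≤e
      ; on-time            = refl
      ; speed≡v            = ≡.refl
      ; announced          = xu≤r
      ; release≤departure  = r≤dep
      ; gap≤δ              = 0≤⇒≤ (≤⇒0≤ xu≤r)
          (solve 3 (λ δ y r → δ := δ :+ y :- r :+ (r :- y)) refl δ (x * u) r)
      }

    -- Induction on the number `suc n` of pieces of length `ℓ` that remain.
    duel : ∀ decide n past x → 0# ≤ x → e - x ≈ fromℕ (suc n) * ℓ → ∃[ Vs ] Duel decide past x Vs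
    -- The last piece needs no `W`: if accepted, it is only `ℓ` long, and the clairvoyant UAV takes
    -- it in any case.
    duel decide zero past x 0≤x e-x≈ℓ = V ∷ [] , record
      { line        = VL ∷ []
      ; sorted      = [-]
      ; ALG-rides≤1 = λ R↭ _ → short (decide past V []) R↭
      ; OPT-route   = λ s s-waiting → V ∷ [] , id , final-truck {s} (x * u) 0≤x s-waiting
      }
      where
      V = truck (x * u) x e
      e≈x+ℓ : e ≈ x + ℓ
      -- `fromℕ 1` unfolds to `1# + 0#`, whence the factor `:1 :+ :0`.
      e≈x+ℓ = modulo e-x≈ℓ (solve 3
        (λ e x ℓ → e := x :+ ℓ :+ :1 :* (e :- x :- (:1 :+ :0) :* ℓ)) refl e x ℓ)
      VL : OnLine x V
      VL = onLine-truck (x * u) (0<⇒< 0<ℓ e≈x+ℓ) ≤-refl ≤-refl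
        (0≤⇒≤ (proj₁ 0<δ) (+-comm δ (x * u)))
      short : ∀ {R} b → R ↭ (if b then V ∷ [] else []) → ridden R ≤ 1#
      short true  R↭ = ≤-trans (≤-reflexive (modulo (ridden-↭ R↭) (modulo e≈x+ℓ (solve 4
        (λ r e x ℓ → r := ℓ :+ :1 :* (r :- (e :- x :+ :0)) :+ :1 :* (e :- (x :+ ℓ)))
        refl _ e x ℓ)))) ℓ≤1
      short false R↭ = ≤-trans (≤-reflexive (ridden-↭ R↭)) (proj₁ 0<1)
    duel decide (suc n) past x 0≤x e-x≈ = answer (decide past V []) ≡.refl
      where
      y = x + ℓ
      V = truck (x * u) x y
      -- Announced when `V` departs, hence strictly after the announcement of `V` because `0<δ`.
      W = truck (δ + x * u) x e
      x<y : x < y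
      x<y = 0<⇒< 0<ℓ refl
      e-y≈ : e - y ≈ fromℕ (suc n) * ℓ
      e-y≈ = modulo e-x≈ (solve 4
        (λ e x ℓ k → e :- (x :+ ℓ) := k :* ℓ :+ :1 :* (e :- x :- (:1 :+ k) :* ℓ))
        refl e x ℓ (fromℕ (suc n)))
      y<e : y < e
      y<e = 0<⇒< (*-pos (fromℕ-pos n) 0<ℓ) (modulo e-y≈ (solve 3
        (λ e y z → e := y :+ z :+ :1 :* (e :- y :- z)) refl e y (fromℕ (suc n) * ℓ)))
      x<e : x < e
      x<e = <-≤-trans x<y (proj₁ y<e)
      xu<yu : x * u < y * u
      xu<yu = 0<⇒< (*-pos 0<ℓ 0<u)
        (solve 3 (λ x ℓ u → (x :+ ℓ) :* u := x :* u :+ ℓ :* u) refl x ℓ u)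
      xu<dep : x * u < δ + x * u
      xu<dep = 0<⇒< 0<δ (+-comm δ (x * u))
      VL : OnLine x V
      VL = onLine-truck (x * u) x<y (proj₁ y<e) ≤-refl (proj₁ xu<dep)
      WL : OnLine x W
      WL = onLine-truck (δ + x * u) x<e ≤-refl (proj₁ xu<dep) ≤-refl

      answer : ∀ b → decide past V [] ≡ b → ∃[ Vs ] Duel decide past x Vs
      answer true  V-accepted = V ∷ W ∷ [] , record
        { line        = VL ∷ WL ∷ []
        ; sorted      = proj₁ xu<dep ∷ [-]
        ; ALG-rides≤1 = λ {s} {R} R↭ → short {s} {R} (decide (past ∷ʳ V) W [])
            (≡.subst (R ↭_) (acceptedAfter-alone decide past (W ∷ []) (xu<dep ∷ []) V-accepted) R↭)
        ; OPT-route   = λ s s-waiting → W ∷ [] , there , final-truck {s} (δ + x * u) 0≤x s-waiting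
        }
        where
        short : ∀ {s R} b → R ↭ (V ∷ (if b then W ∷ [] else [])) → Feasible s R → ridden R ≤ 1#
        short {R = R} false R↭ _ = ≤-trans (≤-reflexive (modulo (ridden-↭ R↭) (solve 3
          (λ r x ℓ → r := ℓ :+ :1 :* (r :- (x :+ ℓ :- x :+ :0))) refl (ridden R) x ℓ))) ℓ≤1
        -- Taking both `V` and `W` would mean riding `e - x + ℓ`, more than the line allows between
        -- `x` and `e`.
        short {s} {R} true  R↭ feasible = contradiction
          (ridden-bound s R (proj₁ x<e) (All-resp-↭ (↭-sym R↭) (VL ∷ WL ∷ [])) feasible)
          (<⇒≱ (0<⇒< 0<ℓ (modulo (ridden-↭ R↭) (solve 4
            (λ r x ℓ e → r := e :- x :+ ℓ :+ :1 :* (r :- (x :+ ℓ :- x :+ (e :- x :+ :0))))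
            refl (ridden R) x ℓ e))))
      answer false V-rejected = V ∷ Vs , record
        { line        = VL ∷ All.map (weaken (proj₁ x<y)) (Duel.line rest)
        ; sorted      = linked (Duel.line rest) (Duel.sorted rest)
        ; ALG-rides≤1 = λ {s} {R} R↭ → Duel.ALG-rides≤1 rest {s} {R}
            (≡.subst (R ↭_) (acceptedAfter-alone decide past Vs later V-rejected) R↭)
        ; OPT-route   = route
        }
        where
        Vs,rest = duel decide n (past ∷ʳ V) y (≤-trans 0≤x (proj₁ x<y)) e-y≈
        Vs   = proj₁ Vs,rest
        rest = proj₂ Vs,rest
        -- The rest is announced from `y * u` on, so the decision on `V` stands whatever the
        -- recursion returns.
        later : All (λ W → x * u < release W) Vs
        later = All.map (λ WL → <-≤-trans xu<yu (OnLine.announced WL)) (Duel.line rest)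
        linked : ∀ {Vs} → All (OnLine y) Vs → Linked (λ V W → release V ≤ release W) Vs →
          Linked (λ V W → release V ≤ release W) (V ∷ Vs)
        linked []       _      = [-]
        linked (WL ∷ _) sorted = ≤-trans (proj₁ xu<yu) (OnLine.announced WL) ∷ sorted
        route : ∀ s → Waiting x s →
          ∃[ R ] R ⊆ V ∷ Vs × Feasible s R × arrival s R ≈ ξ*
        route s s-waiting =
          V ∷ R , ∷⁺ʳ V R⊆Vs , (proj₁ taken , R-feasible) , R-optimal
          where
          taken = after-truck {s} (x * u) y 0≤x s-waiting
          continuation = Duel.OPT-route rest (after s V) (proj₂ taken)
          R = proj₁ continuation
          R⊆Vs = proj₁ (proj₂ continuation)
          R-feasible = proj₁ (proj₂ (proj₂ continuation))
          R-optimal = proj₂ (proj₂ (proj₂ continuation))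

  -- Choice of the delay and of the distance ridden.

  ⌈⌉-pos : ∀ {x} → 0# < x → ∃[ n ] fromℤ ⌈ x ⌉ ≡ fromℕ (suc n)
  ⌈⌉-pos {x} 0<x with ⌈ x ⌉ | ⌈⌉-upper x
  ... | + zero   | x≤0 = contradiction x≤0 (<⇒≱ 0<x)
  ... | + suc n  | _   = n , ≡.refl
  ... | -[1+ n ] | x≤- = contradiction
    (≤-trans x≤- (0≤⇒≤ (proj₁ (fromℕ-pos n)) (solve 1 (λ k → :0 := :- k :+ k) refl (fromℕ (suc n)))))
    (<⇒≱ 0<x)

  0<β-α : 0# < β - α
  0<β-α = <⇒0< α<β

  w≤u : w ≤ u
  w≤u = ⁻¹-antimono 0<v (proj₁ v<v₀)

  0<a : 0# < a
  0<a = *-cancel-pos (*-pos 0<β-α 0<w) (<-≤-trans (≤-<-trans 0≤P₀ P₀-small)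
    (≤-reflexive (solve 3 (λ b a w → b :* a :* w := a :* (b :* w)) refl (β - α) a w)))

  0<T-ra : 0# < T-ra
  0<T-ra = <-≤-trans (*-pos (<⇒0< P₀-small) 0<g) (≤-reflexive (solve 5
    (λ b g a w p → (b :* a :* w :- p) :* g := b :* g :* (a :* w) :- p :* g) refl (β - α) g a w P₀))

  T-ra≈ : T-ra ≈ β * g * w * a - a * w - g * P₀
  T-ra≈ = modulo αg≈1 (solve 6
    (λ β α g a w p → (β :- α) :* g :* (a :* w) :- p :* g
      := β :* g :* w :* a :- a :* w :- g :* p :+ (:- (a :* w)) :* (α :* g :- :1))
    refl β α g a w P₀)

  -- The stopping time saved per unit of distance ridden.
  C : Carrier
  C = u - w + β * g * w

  denominator : Carrier
  denominator = v₀ * α - v * α + v * β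

  0<denominator : 0# < denominator
  0<denominator = <-≤-trans (+-pos-nonneg (*-pos 0<v₀ 0<α) (proj₁ (*-pos 0<v 0<β-α)))
    (≤-reflexive (solve 4 (λ v₀ α v β → v₀ :* α :+ v :* (β :- α) := v₀ :* α :- v :* α :+ v :* β)
      refl v₀ α v β))

  0<C : 0# < C
  0<C = <-≤-trans (+-pos-nonneg (*-pos (*-pos 0<β 0<g) 0<w) (≤⇒0≤ w≤u))
    (≤-reflexive (+-comm _ _))

  -- `T-ra` is the stopping time of a UAV without rides; so `L-min` is the distance that, ridden
  -- without delay, just removes all stops.
  L-min*C≈T-ra : L-min * C ≈ T-ra
  L-min*C≈T-ra = trans (*-congˡ C≈) (trans L-min*D≈ (sym T-ra≈′))
    where
    C≈ : C ≈ denominator * (u * w * g)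
    C≈ = modulo v₀w≈1 (modulo αg≈1 (modulo vu≈1 (solve 7
      (λ v₀ α v β u w g → u :- w :+ β :* g :* w
        := (v₀ :* α :- v :* α :+ v :* β) :* (u :* w :* g)
           :+ (:- (u :* (α :* g))) :* (v₀ :* w :- :1)
           :+ (w :- u) :* (α :* g :- :1)
           :+ (α :* w :* g :- β :* w :* g) :* (v :* u :- :1))
      refl v₀ α v β u w g)))
    N = a * β - a * α - P₀ * v₀
    L-min*D≈ : L-min * (denominator * (u * w * g)) ≈ N * w * g
    L-min*D≈ = modulo (*-inverse 0<denominator) (modulo vu≈1 (solve 7
      (λ N v D D⁻¹ u w g → N :* v :* D⁻¹ :* (D :* (u :* w :* g))
        := N :* w :* g :+ (N :* v :* (u :* w :* g)) :* (D :* D⁻¹ :- :1) :+ (N :* w :* g) :* (v :* u :- :1))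
      refl N v denominator (denominator ⁻¹) u w g))
    T-ra≈′ : T-ra ≈ N * w * g
    T-ra≈′ = modulo v₀w≈1 (solve 7
      (λ a β α v₀ w g p → (β :- α) :* g :* (a :* w) :- p :* g
        := (a :* β :- a :* α :- p :* v₀) :* w :* g :+ (p :* g) :* (v₀ :* w :- :1))
      refl a β α v₀ w g P₀)

  0<L-min : 0# < L-min
  0<L-min = *-cancel-pos 0<C (<-≤-trans 0<T-ra (≤-reflexive (sym L-min*C≈T-ra)))

  -- The delay δ = T-ra * q is less than both T-ra and 1/v₀.
  q δ e : Carrier
  q = (1# + T-ra * v₀) ⁻¹
  δ = T-ra * q
  e = L-min * (T-ra * v₀ * q)

  0<1+Tv₀ : 0# < 1# + T-ra * v₀
  0<1+Tv₀ = +-pos-nonneg 0<1 (proj₁ (*-pos 0<T-ra 0<v₀))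

  0<q = ⁻¹-pos 0<1+Tv₀
  q-inverse = *-inverse 0<1+Tv₀

  0<δ : 0# < δ
  0<δ = *-pos 0<T-ra 0<q

  0<e : 0# < e
  0<e = *-pos 0<L-min (*-pos (*-pos 0<T-ra 0<v₀) 0<q)

  e≤L-min : e ≤ L-min
  e≤L-min = 0≤⇒≤ (proj₁ (*-pos 0<L-min 0<q)) (modulo q-inverse (solve 4
    (λ L T v₀ q → L := L :* (T :* v₀ :* q) :+ L :* q :+ (:- L) :* ((:1 :+ T :* v₀) :* q :- :1))
    refl L-min T-ra v₀ q))

  δ≤w : δ ≤ w
  δ≤w = 0≤⇒≤ (proj₁ (*-pos 0<w 0<q)) (modulo q-inverse (modulo v₀w≈1 (solve 4
    (λ w T v₀ q → w := T :* q :+ w :* q :+ (:- w) :* ((:1 :+ T :* v₀) :* q :- :1)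
        :+ (T :* q) :* (v₀ :* w :- :1))
    refl w T-ra v₀ q)))

  -- Charging during the delay replaces `δ` of the stopping time, and riding `e` must save the rest.
  -- As `T-ra * v₀ * q` is `1# - q`, both sides are `T-ra` scaled by it.
  e*C≈ : e * C ≈ T-ra - δ
  e*C≈ = modulo L-min*C≈T-ra (modulo q-inverse (solve 5
    (λ L T v₀ q C → L :* (T :* v₀ :* q) :* C
      := T :- T :* q :+ (T :* v₀ :* q) :* (L :* C :- T) :+ T :* ((:1 :+ T :* v₀) :* q :- :1))
    refl L-min T-ra v₀ q C))

  δ≤T-ra : δ ≤ T-ra
  δ≤T-ra = 0≤⇒≤ (proj₁ (*-pos 0<e 0<C)) (modulo (sym e*C≈) (solve 3
    (λ δ T z → T := δ :+ z :+ :1 :* (T :- δ :- z)) refl δ T-ra (e * C)))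

  δ≤maxGap : δ ≤ T-ra + T-f0
  δ≤maxGap = ≤-trans δ≤T-ra (0≤⇒≤ (*-nonneg 0≤P₀ (proj₁ (⁻¹-pos 0<β-α))) refl)

  -- `(a - e) * C` works out to `a * u + g * P₀ + δ`, a sum of nonnegative terms.
  e≤a : e ≤ a
  e≤a = 0≤⇒≤ (*-cancel-nonneg 0<C (≤-trans
      (+-nonneg (+-nonneg (proj₁ (*-pos 0<a 0<u)) (*-nonneg (proj₁ 0<g) 0≤P₀)) (proj₁ 0<δ))
      (≤-reflexive (sym (modulo e*C≈ (modulo T-ra≈ (solve 9
        (λ a e u w β g p δ T → (a :- e) :* (u :- w :+ β :* g :* w)
          := a :* u :+ g :* p :+ δ :+ (:- :1) :* (e :* (u :- w :+ β :* g :* w) :- (T :- δ))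
             :+ (:- :1) :* (T :- (β :* g :* w :* a :- a :* w :- g :* p)))
        refl a e u w β g P₀ δ T-ra)))))))
    (solve 2 (λ a e → a := e :+ (a :- e)) refl a e)

  tight : δ + e * u + (a - e) * w ≈ β * g * w * (a - e) - g * P₀
  tight = modulo e*C≈ (modulo T-ra≈ (solve 9
    (λ a e u w β g p δ T → δ :+ e :* u :+ (a :- e) :* w
      := β :* g :* w :* (a :- e) :- g :* p :+ :1 :* (e :* (u :- w :+ β :* g :* w) :- (T :- δ))
         :+ :1 :* (T :- (β :* g :* w :* a :- a :* w :- g :* p)))
    refl a e u w β g P₀ δ T-ra))

  n : ℕ
  n = proj₁ (⌈⌉-pos 0<L-min)

  0<⌈L-min⌉ : 0# < fromℕ (suc n)
  0<⌈L-min⌉ = fromℕ-pos n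

  e≤⌈L-min⌉ : e ≤ ⌈L-min⌉
  e≤⌈L-min⌉ = ≤-trans e≤L-min (⌈⌉-upper L-min)

  e≤suc-n : e ≤ fromℕ (suc n)
  e≤suc-n = e≤⌈L-min⌉ ≤≈ reflexive (proj₂ (⌈⌉-pos 0<L-min))

  ℓ : Carrier
  ℓ = e * fromℕ (suc n) ⁻¹

  0<ℓ : 0# < ℓ
  0<ℓ = *-pos 0<e (⁻¹-pos 0<⌈L-min⌉)

  ℓ≤1 : ℓ ≤ 1#
  ℓ≤1 = 0≤⇒≤ (*-nonneg (≤⇒0≤ e≤suc-n) (proj₁ (⁻¹-pos 0<⌈L-min⌉)))
    (modulo (*-inverse 0<⌈L-min⌉) (solve 3
      (λ e k k⁻¹ → :1 := e :* k⁻¹ :+ (k :- e) :* k⁻¹ :+ (:- :1) :* (k :* k⁻¹ :- :1))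
      refl e (fromℕ (suc n)) (fromℕ (suc n) ⁻¹)))

  e-0≈ : e - 0# ≈ fromℕ (suc n) * ℓ
  e-0≈ = modulo (*-inverse 0<⌈L-min⌉) (solve 3
      (λ e k k⁻¹ → e :- :0 := k :* (e :* k⁻¹) :+ (:- e) :* (k :* k⁻¹ :- :1))
      refl e (fromℕ (suc n)) (fromℕ (suc n) ⁻¹))

  -- The ratio achieved against any algorithm.

  open Line δ e ℓ 0<δ (proj₁ 0<e) 0<ℓ ℓ≤1 tight

  0<ξ* : 0# < ξ*
  0<ξ* = +-pos-nonneg (+-pos-nonneg 0<δ (proj₁ (*-pos 0<e 0<u)))
    (*-nonneg (≤⇒0≤ e≤a) (proj₁ 0<w))

  -- Trucks at speed `v` are slower than flight, so lengthening the ride from `e` to `⌈L-min⌉` only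
  -- adds time; the extra `1#` in the numerator pays for `δ≤w`.
  ξ*≤ : ξ* ≤ ⌈L-min⌉ / v + (a + 1# - ⌈L-min⌉) / v₀
  ξ*≤ = 0≤⇒≤ (+-nonneg (*-nonneg (≤⇒0≤ e≤⌈L-min⌉) (≤⇒0≤ w≤u)) (≤⇒0≤ δ≤w))
    (solve 6 (λ k u w a δ e → k :* u :+ (a :+ :1 :- k) :* w
      := δ :+ e :* u :+ (a :- e) :* w :+ ((k :- e) :* (u :- w) :+ (w :- δ)))
      refl ⌈L-min⌉ u w a δ e)

  -- Without rides the energy bound is `ξ∅`, and each unit ridden lowers it by `β * g * w`, which is
  -- `T-mu`.
  short-ride-bound : ∀ R → ridden R ≤ 1# → ξ∅ - T-mu ≤ arrival start R
  short-ride-bound R R≤1 = ≤-trans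
    (0≤⇒≤ (*-nonneg (*-nonneg (*-nonneg (proj₁ 0<β) (proj₁ 0<g)) (proj₁ 0<w)) (≤⇒0≤ R≤1))
      (modulo αv₀⁻¹≈ (solve 7
        (λ β g w a p r z → :0 :- g :* p :+ β :* g :* w :* (a :- :0 :- r)
          := β :* g :* (a :* w) :- p :* g :- β :* z :+ β :* g :* w :* (:1 :- r)
             :+ β :* (z :- g :* w))
        refl β g w a P₀ (ridden R) ((α * v₀) ⁻¹))))
    (arrival-bound start R)
    where
    αv₀⁻¹≈ : (α * v₀) ⁻¹ ≈ g * w
    αv₀⁻¹≈ = ⁻¹-unique (*-pos 0<α 0<v₀) (modulo αg≈1 (modulo v₀w≈1 (solve 4
      (λ α v₀ g w → α :* v₀ :* (g :* w) := :1 :+ (v₀ :* w) :* (α :* g :- :1) :+ :1 :* (v₀ :* w :- :1))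
      refl α v₀ g w)))

  OnLine⇒ValidRide : ∀ {V} → OnLine 0# V → ValidRide (T-ra + T-f0) V
  OnLine⇒ValidRide VL = record
    { 0≤release          = ≤-trans (≤-reflexive (sym (zeroˡ u))) announced
    ; release≤departure  = release≤departure
    ; gap≤maxGap         = ≤-trans gap≤δ δ≤maxGap
    ; 0≤origin           = x≤origin
    ; origin<destination = origin<destination
    ; destination≤a      = ≤-trans destination≤e e≤a
    ; v≤speed            = ≤-reflexive (reflexive (≡.sym speed≡v))
    }
    where open OnLine VL

  start-waiting : Waiting 0# start
  start-waiting = waiting refl
    (≤-trans (proj₁ 0<δ) (≤-reflexive (solve 2 (λ δ u → δ := δ :+ :0 :* u) refl δ u)))
    (solve 2 (λ p α → p := p :+ :0 :* α) refl P₀ α)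

  -- The numerator is raised first: shrinking the denominator requires a nonnegative numerator, and
  -- `ξ∅ - T-mu` may be negative when `a` is below 1.
  lowerBound≤ratio : ∀ {ξ} → ξ∅ - T-mu ≤ ξ → 0# ≤ ξ → lowerBound ≤ ξ / ξ*
  lowerBound≤ratio {ξ} N≤ξ 0≤ξ = ≤-trans
    (0≤⇒≤ (*-nonneg (≤⇒0≤ N≤ξ) (proj₁ (⁻¹-pos 0<D)))
      (solve 3 (λ ξ N D⁻¹ → ξ :* D⁻¹ := N :* D⁻¹ :+ (ξ :- N) :* D⁻¹) refl ξ (ξ∅ - T-mu) (D ⁻¹)))
    (0≤⇒≤ (*-nonneg 0≤ξ (≤⇒0≤ (⁻¹-antimono 0<ξ* ξ*≤)))
      (solve 3 (λ ξ a b → ξ :* b := ξ :* a :+ ξ :* (b :- a)) refl ξ (D ⁻¹) (ξ* ⁻¹)))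
    where
    D = ⌈L-min⌉ / v + (a + 1# - ⌈L-min⌉) / v₀
    0<D = <-≤-trans 0<ξ* ξ*≤

  not-competitive : (ALG : OnlineAlgorithm (T-ra + T-f0)) (ρ : Carrier) →
    ρ < lowerBound → ¬ IsCompetitive ALG ρ
  not-competitive ALG ρ ρ<lowerBound competitive = <⇒≱ ρ<lowerBound (≤-trans
    (lowerBound≤ratio (short-ride-bound (route I) (ALG-rides≤1 (route-accepted I) (route-feasible I)))
      -- The accepted rides lie on the line too, so the algorithm arrives no earlier than the
      -- positive `ξ*`.
      (≤-trans (proj₁ 0<ξ*) (ξ*≤arrival
        (All-resp-⊇ (acceptedAfter-⊆ decide [] Vs ∘ ∈-resp-↭ (route-accepted I)) line) (route-feasible I))))
    (competitive I ξ*
      ( OPT-route start start-waiting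
      , λ R R⊆Vs → ξ*≤arrival (All-resp-⊇ R⊆Vs line))))
    where
    open OnlineAlgorithm ALG
    -- The game starts at 0 with `suc n` pieces, the value of `⌈L-min⌉`.
    Vs,duel = duel decide n [] 0# ≤-refl e-0≈
    Vs = proj₁ Vs,duel
    open Duel (proj₂ Vs,duel)
    I : Instance (T-ra + T-f0) Vs
    I = record { valid = All.map OnLine⇒ValidRide line ; sorted = sorted }

theorem3 : ∀ {c ℓ₁ ℓ₂} (F : ArchimedeanField c ℓ₁ ℓ₂) →
    let open ArchimedeanField F
        open RideHitching F in
    (params : Parameters) →
    let open Game params in
    (ALG : OnlineAlgorithm (T-ra + T-f0)) (ρ : Carrier) →
    ρ < lowerBound → ¬ IsCompetitive ALG ρ
theorem3 F params = Adversary.not-competitive F params
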